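{- Let $D=(V,F)$ be a permutation digraph with underlying undirected graph $G$. Let $M$ be a degenerate $0$-node of the modular decomposition tree of $G$, and let $\mathcal{C}=\{X_1,X_2,\dots,X_m\}$ be a set of children of $M$ that induce isomorphic directed subgraphs of $D$; let $g_{ij}$ denote an isomorphism $D|X_i\to D|X_j$. For any $\rho\in S_m$, define $f_\rho:V\to V$ by \[ f_\rho(v)=\begin{cases} g_{i\rho(i)}(v), & \text{if } v\in X_i \text{ for some } 1\le i\le m,\\ v, & \text{if } v\notin \bigcup\mathcal{C}.\end{cases} \] For any transitive orientation $F_1$ on the complement $G^c$, define another orientation $F_2$ by \[ (f_\rho(v),f_\rho(w))\in F_2 \iff (v,w)\in F_1 . \] Then $F_2$ is also a transitive orientation on $G^c$. Moreover, $F\cup F_1$ and $F\cup F_2$ induce the same permutation.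
   Context: Inversion set: for $\pi\in S_n$, $E(\pi)=\{(i,j):1\le i<j\le n,\ \pi^{ -1}(i)>\pi^{ -1}(j)\}$; $D(\pi)$ is the digraph with vertex set $\{1,\dots,n\}$ and arc set $E(\pi)$. A permutation digraph is a digraph isomorphic to $D(\pi)$ for some $n$ and some $\pi\in S_n$. $D|X$ denotes the subdigraph induced by $X\subseteq V$. An orientation of a graph assigns exactly one direction to each edge; it is a transitive orientation $F$ if $(u,v),(v,w)\in F$ implies $(u,w)\in F$. Induced permutation: if $|V|=n$ and $F,F_1$ are transitive orientations of $G$ and $G^c$ respectively, then $(V,F\cup F_1)$ is a transitively oriented complete graph, so there is a unique bijection $L:V\to\{1,\dots,n\}$ with $L(v)<L(w)\iff (v,w)\in F\cup F_1$; there is a unique $\pi\in S_n$ with $E(\pi)=\{(L(v),L(w)):(v,w)\in F\}$, called the permutation induced by $F\cup F_1$. Modular decomposition: a module of $G=(V,E)$ is a set $M\subseteq V$ such that each vertex outside $M$ is adjacent to all or to none of the vertices of $M$. Two modules overlap if $M\cap N$, $M\setminus N$, $N\setminus M$ are all non-empty; a module is strong if it overlaps no other module. The modular decomposition tree of $G$ has the (non-empty) strong modules of $G$ as nodes and $V$ as root; the children of a node $M$ with $|M|>1$ are: the connected components of $G|M$ if $G|M$ is disconnected ($M$ is then a degenerate $0$-node); the connected components of $G^c|M$ if $G|M$ is connected and $G^c|M$ is disconnected (degenerate $1$-node); the maximal proper submodules of $M$ if both $G|M$ and $G^c|M$ are connected (prime node). -}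

module Defs where

open import Level using (0ℓ)
open import Data.Fin using (Fin; _<_)
open import Data.Fin.Properties using (any?)
open import Data.Fin.Permutation using (Permutation′; _⟨$⟩ʳ_; _⟨$⟩ˡ_)
open import Data.Fin.Subset using (Subset; _∈_; _∉_; _⊆_; _⊂_; _∩_; _─_; ∣_∣; Nonempty)
open import Data.Fin.Subset.Properties using (_∈?_)
open import Data.Nat as ℕ using (ℕ)
open import Data.Product using (Σ; ∃; ∃₂; _×_; _,_; proj₁)
open import Data.Sum using (_⊎_)
open import Function using (_on_)
open import Function.Bundles using (_↔_; _⇔_; Inverse)
open import Relation.Binary using (Rel; Transitive; _⇒_)
open import Relation.Binary.Construct.Closure.ReflexiveTransitive using (Star)
open import Relation.Binary.Construct.Closure.Symmetric using (SymClosure)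
open import Relation.Binary.PropositionalEquality using (_≡_; _≢_)
open import Relation.Nullary using (¬_; yes; no)

private
  variable
    m n : ℕ
    V W : Set

-- A digraph on V is its arc relation and a graph on V is its (symmetric)
-- adjacency relation.  Finite vertex sets are Fin n, with the labels
-- {1,…,n} of the mathematics shifted to {0,…,n-1}.

record _≅_ (F : Rel V 0ℓ) (F′ : Rel W 0ℓ) : Set where
  field
    bijection : V ↔ W
  open Inverse bijection public using (to; from)
  field
    arcs : ∀ u v → F u v ⇔ F′ (to u) (to v)

_∣_ : Rel (Fin n) 0ℓ → (X : Subset n) → Rel (∃ (_∈ X)) 0ℓ
R ∣ X = R on proj₁

-- _⟨$⟩ˡ_ applies the inverse permutation.
E : Permutation′ n → Rel (Fin n) 0ℓ
E π i j = i < j × π ⟨$⟩ˡ j < π ⟨$⟩ˡ i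

IsPermutationDigraph : Rel V 0ℓ → Set
IsPermutationDigraph F = ∃ λ k → Σ (Permutation′ k) λ π → F ≅ E π

Underlying : Rel V 0ℓ → Rel V 0ℓ
Underlying F = SymClosure F

Complement : Rel V 0ℓ → Rel V 0ℓ
Complement G u v = u ≢ v × ¬ G u v

record IsTransitiveOrientation (G F : Rel V 0ℓ) : Set where
  field
    edge        : F ⇒ G
    exactly-one : ∀ {u v} → G u v → (F u v × ¬ F v u) ⊎ (¬ F u v × F v u)
    transitive  : Transitive F

-- π is the permutation induced by F ∪ F₁.
Induces : Rel (Fin n) 0ℓ → Rel (Fin n) 0ℓ → Permutation′ n → Set
Induces {n} F F₁ π = Σ (Fin n ↔ Fin n) λ L → let open Inverse L using (to) in
  (∀ v w → (to v < to w) ⇔ (F v w ⊎ F₁ v w)) ×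
  (∀ i j → E π i j ⇔ (∃₂ λ v w → to v ≡ i × to w ≡ j × F v w))

Connected : Rel V 0ℓ → Set
Connected G = ∀ u v → Star G u v

-- X is (the vertex set of) a connected component of G ∣ M: an equivalence
-- class of reachability inside M.
record IsComponent (G : Rel (Fin n) 0ℓ) (M X : Subset n) : Set where
  field
    nonempty : Nonempty X
    subset   : X ⊆ M
    class    : ∀ {u v} (u∈M : u ∈ M) (v∈M : v ∈ M) → u ∈ X →
               (v ∈ X) ⇔ Star (G ∣ M) (u , u∈M) (v , v∈M)

IsModule : Rel (Fin n) 0ℓ → Subset n → Set
IsModule G M = ∀ v → v ∉ M → (∀ u → u ∈ M → G v u) ⊎ (∀ u → u ∈ M → ¬ G v u)

Overlap : Subset n → Subset n → Set
Overlap M N = Nonempty (M ∩ N) × Nonempty (M ─ N) × Nonempty (N ─ M)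

IsStrongModule : Rel (Fin n) 0ℓ → Subset n → Set
IsStrongModule G M = IsModule G M × (∀ N → IsModule G N → ¬ Overlap M N)

IsMaximalProperSubmodule : Rel (Fin n) 0ℓ → Subset n → Subset n → Set
IsMaximalProperSubmodule G M X =
  IsModule G X × X ⊂ M × (∀ Y → IsModule G Y → Y ⊂ M → X ⊆ Y → Y ⊆ X)

-- Nodes of the modular decomposition tree of G.
IsNode : Rel (Fin n) 0ℓ → Subset n → Set
IsNode G M = Nonempty M × IsStrongModule G M

record IsDegenerate0 (G : Rel (Fin n) 0ℓ) (M : Subset n) : Set where
  field
    node         : IsNode G M
    nontrivial   : 1 ℕ.< ∣ M ∣
    disconnected : ¬ Connected (G ∣ M)

record IsDegenerate1 (G : Rel (Fin n) 0ℓ) (M : Subset n) : Set where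
  field
    node            : IsNode G M
    nontrivial      : 1 ℕ.< ∣ M ∣
    connected       : Connected (G ∣ M)
    co-disconnected : ¬ Connected (Complement G ∣ M)

record IsPrime (G : Rel (Fin n) 0ℓ) (M : Subset n) : Set where
  field
    node         : IsNode G M
    nontrivial   : 1 ℕ.< ∣ M ∣
    connected    : Connected (G ∣ M)
    co-connected : Connected (Complement G ∣ M)

-- IsChild G M X: X is a child of M in the modular decomposition tree of G.
data IsChild (G : Rel (Fin n) 0ℓ) (M X : Subset n) : Set where
  child₀ : IsDegenerate0 G M → IsComponent G M X → IsChild G M X
  child₁ : IsDegenerate1 G M → IsComponent (Complement G) M X → IsChild G M X
  childₚ : IsPrime G M → IsMaximalProperSubmodule G M X → IsChild G M X

-- The map f_ρ.  For pairwise disjoint X i, as for distinct children of one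
-- node, the index found by any? is the only one possible.
shuffle : {F : Rel (Fin n) 0ℓ} (X : Fin m → Subset n) →
          (∀ i j → (F ∣ X i) ≅ (F ∣ X j)) →
          Permutation′ m → Fin n → Fin n
shuffle X g ρ v with any? (λ i → v ∈? X i)
... | yes (i , v∈Xᵢ) = proj₁ (_≅_.to (g i (ρ ⟨$⟩ʳ i)) (v , v∈Xᵢ))
... | no  _          = v

IsImageUnder : (V → V) → Rel V 0ℓ → Rel V 0ℓ → Set
IsImageUnder f F₁ F₂ = ∀ v w → F₂ (f v) (f w) ⇔ F₁ v w

{-# OPTIONS --safe #-}
-- A vertex outside the module M has the same arcs to any two vertices of M
-- which are non-adjacent, because F is transitive; since G ∣ M is
-- disconnected, any two vertices of M are linked by at most two
-- non-adjacencies.  Hence f_ρ is an automorphism of F, so it carries F₁ to a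
-- transitive orientation of the complement, and composing the linear order
-- of F ∪ F₁ with the inverse of f_ρ gives that of F ∪ F₂ with the same π.
-- For the existence of π, both F ∪ F₁ and (flip F) ∪ F₁ are strict total
-- orders; π maps the position of a vertex in the second to its position in
-- the first.
module Submission where

open import Defs
open import Level using (0ℓ)
open import Data.Nat as ℕ using (ℕ; suc)
import Data.Nat.Properties as ℕ
open import Data.Fin using (Fin; fromℕ<; punchOut; _<_)
open import Data.Fin.Properties using (_≟_; any?; <-irrefl; <-trans; <-asym; _<?_; toℕ-fromℕ<; punchOut-injective; injective⇒≤)
open import Data.Fin.Permutation using (Permutation′; _⟨$⟩ʳ_; _⟨$⟩ˡ_; inverseˡ; inverseʳ; permutation; _∘ₚ_; flip)
open import Data.Fin.Subset using (Subset; _∈_; _∉_; ∣_∣)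
open import Data.Fin.Subset.Properties using (_∈?_; p⊂q⇒∣p∣<∣q∣; ∈⊤; ∣⊤∣≡n; ⊆-antisym)
open import Data.Product as Product using (Σ; ∃; _×_; _,_; proj₁; proj₂)
open import Data.Sum as Sum using (_⊎_; inj₁; inj₂; [_,_]′)
open import Data.Vec using (tabulate)
open import Data.Vec.Properties using (lookup⇒[]=; []=⇒lookup; lookup∘tabulate)
open import Data.Vec.Properties.WithK using ([]=-irrelevant)
open import Function as Fun using (_∘_)
open import Function.Bundles using (_⇔_; mk⇔; Injection; Equivalence)
open import Function.Construct.Identity using (⇔-id)
open import Function.Construct.Symmetry using (⇔-sym)
open import Function.Definitions using (Injective)
open import Function.Properties.Inverse using (↔⇒↣)
open import Relation.Binary using (Rel; Trichotomous; tri<; tri≈; tri>; IsStrictTotalOrder; IsDecStrictPartialOrder)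
open import Relation.Binary.Construct.Closure.ReflexiveTransitive using (ε; _◅_)
open import Relation.Binary.Construct.Closure.Symmetric using (SymClosure; fwd; bwd; symmetric)
import Relation.Binary.Construct.Flip.EqAndOrd as Flip
open import Relation.Binary.Construct.Union using (_∪_)
open import Relation.Binary.PropositionalEquality using (_≡_; _≢_; refl; sym; trans; cong; subst; subst₂; isEquivalence; resp₂)
open import Relation.Binary.Structures.Biased using (isStrictTotalOrderᶜ)
open import Relation.Nullary using (¬_; yes; no; does; contradiction)
open import Relation.Nullary.Decidable using (map′; dec-true; _×-dec_; ¬?; decidable-stable)

open Equivalence using (to; from)

private
  variable
    m n : ℕ
    V : Set

-- Injective self-maps of a finite set, and ranks in a finite total order.

-- If `y` were missed, punching it out of the codomain would inject `Fin (suc n)` into `Fin n`.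
injective⇒∃preimage : {f : Fin n → Fin n} → Injective _≡_ _≡_ f → ∀ y → ∃ λ x → f x ≡ y
injective⇒∃preimage {suc n} {f} f-inj y with any? (λ x → f x ≟ y)
... | yes hit  = hit
... | no  miss = contradiction (injective⇒≤ avoid-injective) ℕ.1+n≰n
  where
  avoid : ∀ x → y ≢ f x
  avoid x y≡fx = miss (x , sym y≡fx)

  avoid-injective : Injective _≡_ _≡_ (λ x → punchOut (avoid x))
  avoid-injective {x} {x′} = f-inj ∘ punchOut-injective (avoid x) (avoid x′)

injective⇒permutation : (f : Fin n → Fin n) → Injective _≡_ _≡_ f →
                        Σ (Permutation′ n) λ φ → ∀ v → φ ⟨$⟩ʳ v ≡ f v
injective⇒permutation f f-inj =
  permutation f (proj₁ ∘ onto) (proj₂ ∘ onto) (λ v → f-inj (proj₂ (onto (f v)))) , λ _ → refl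
  where onto = injective⇒∃preimage f-inj

-- The rank of a vertex is the number of its predecessors. Transitivity and irreflexivity make the
-- sets of predecessors grow strictly along the order; trichotomy then gives reflection and
-- injectivity.
strictTotalOrder⇒ranking : {_≺_ : Rel (Fin n) 0ℓ} → IsStrictTotalOrder _≡_ _≺_ →
  Σ (Permutation′ n) λ L → ∀ v w → (L ⟨$⟩ʳ v < L ⟨$⟩ʳ w) ⇔ (v ≺ w)
strictTotalOrder⇒ranking {n} {_≺_} isSTO =
  proj₁ L , λ v w → subst₂ (λ i j → (i < j) ⇔ (v ≺ w)) (sym (proj₂ L v)) (sym (proj₂ L w))
                      (mk⇔ (reflects v w) (monotone v w))
  where
  open IsStrictTotalOrder isSTO using (compare; irrefl) renaming (_<?_ to _≺?_; trans to ≺-trans)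

  below : Fin n → Subset n
  below v = tabulate (λ u → does (u ≺? v))

  ∈below⁺ : ∀ {u v} → u ≺ v → u ∈ below v
  ∈below⁺ {u} {v} u≺v =
    lookup⇒[]= u _ (trans (lookup∘tabulate _ u) (dec-true (u ≺? v) u≺v))

  ∈below⁻ : ∀ {u v} → u ∈ below v → u ≺ v
  ∈below⁻ {u} {v} u∈ with u ≺? v | trans (sym (lookup∘tabulate (λ x → does (x ≺? v)) u)) ([]=⇒lookup u∈)
  ... | yes u≺v | _ = u≺v
  ... | no  _   | ()

  v∉below-v : ∀ v → v ∉ below v
  v∉below-v v = irrefl refl ∘ ∈below⁻

  ∣below∣<n : ∀ v → ∣ below v ∣ ℕ.< n
  -- `below v` misses `v`, so its size is a valid element of `Fin n` with no shift.
  ∣below∣<n v = subst (∣ below v ∣ ℕ.<_) (∣⊤∣≡n n)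
    (p⊂q⇒∣p∣<∣q∣ ((λ _ → ∈⊤) , v , ∈⊤ , v∉below-v v))

  rank : Fin n → Fin n
  rank v = fromℕ< (∣below∣<n v)

  monotone : ∀ v w → v ≺ w → rank v < rank w
  monotone v w v≺w = subst₂ ℕ._<_ (sym (toℕ-fromℕ< (∣below∣<n v))) (sym (toℕ-fromℕ< (∣below∣<n w)))
    (p⊂q⇒∣p∣<∣q∣ ((λ u∈ → ∈below⁺ (≺-trans (∈below⁻ u∈) v≺w)) , v , ∈below⁺ v≺w , v∉below-v v))

  reflects : ∀ v w → rank v < rank w → v ≺ w
  reflects v w rv<rw with compare v w
  ... | tri< v≺w _ _    = v≺w
  ... | tri≈ _ refl _   = contradiction rv<rw (<-irrefl refl)
  ... | tri> _ _ w≺v    = contradiction (monotone w v w≺v) (<-asym rv<rw)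

  rank-injective : Injective _≡_ _≡_ rank
  rank-injective {v} {w} rv≡rw with compare v w
  ... | tri< v≺w _ _ = contradiction (monotone v w v≺w) (<-irrefl rv≡rw)
  ... | tri≈ _ v≡w _ = v≡w
  ... | tri> _ _ w≺v = contradiction (monotone w v w≺v) (<-irrefl (sym rv≡rw))

  L = injective⇒permutation rank rank-injective

-- The strict orders formed by `F` and `F ∪ F₁`.

-- `E π` is the intersection of two decidable strict orders, by value and by reversed position, and
-- the isomorphism pulls their properties back to `F`.
permutationDigraph⇒isDecStrictPartialOrder : {F : Rel (Fin n) 0ℓ} → IsPermutationDigraph F →
                                             IsDecStrictPartialOrder _≡_ F
permutationDigraph⇒isDecStrictPartialOrder {F = F} (_ , π , iso) = record
  { isStrictPartialOrder = record
    { isEquivalence = isEquivalence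
    ; irrefl        = λ { refl Fvv → <-irrefl refl (proj₁ (to (arcs _ _) Fvv)) }
    ; trans         = λ Fuv Fvw → from (arcs _ _)
        (Product.zip <-trans (Fun.flip <-trans) (to (arcs _ _) Fuv) (to (arcs _ _) Fvw))
    ; <-resp-≈      = resp₂ F
    }
  ; _≟_  = _≟_
  ; _<?_ = λ u v → map′ (from (arcs u v)) (to (arcs u v)) (_ <? _ ×-dec _ <? _)
  }
  where open _≅_ iso using (arcs)

module _ {F : Rel (Fin n) 0ℓ} (isDecSPO : IsDecStrictPartialOrder _≡_ F)
         {F₁ : Rel (Fin n) 0ℓ} (isTO : IsTransitiveOrientation (Complement (Underlying F)) F₁) where

  open IsDecStrictPartialOrder isDecSPO using (irrefl; asym) renaming (_<?_ to _F?_; trans to F-trans)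
  open IsTransitiveOrientation isTO

  private
    F₁⇒¬F⁻¹ : ∀ {u v} → F₁ u v → ¬ F v u
    F₁⇒¬F⁻¹ F₁uv Fvu = proj₂ (edge F₁uv) (bwd Fvu)

    compare : Trichotomous _≡_ (F ∪ F₁)
    compare u v with u ≟ v
    ... | yes refl = tri≈ loop refl loop
      where
      loop : ¬ (F ∪ F₁) u u
      loop = [ irrefl refl , (λ F₁uu → proj₁ (edge F₁uu) refl) ]′
    ... | no u≢v with u F? v | v F? u
    ...   | yes Fuv | _       = tri< (inj₁ Fuv) u≢v [ asym Fuv , (λ F₁vu → F₁⇒¬F⁻¹ F₁vu Fuv) ]′
    ...   | no _    | yes Fvu = tri> [ asym Fvu , (λ F₁uv → F₁⇒¬F⁻¹ F₁uv Fvu) ]′ u≢v (inj₁ Fvu)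
    ...   | no ¬Fuv | no ¬Fvu with exactly-one (u≢v , λ { (fwd Fuv) → ¬Fuv Fuv ; (bwd Fvu) → ¬Fvu Fvu })
    ...     | inj₁ (F₁uv , ¬F₁vu) = tri< (inj₂ F₁uv) u≢v [ ¬Fvu , ¬F₁vu ]′
    ...     | inj₂ (¬F₁uv , F₁vu) = tri> [ ¬Fuv , ¬F₁uv ]′ u≢v (inj₂ F₁vu)

    ∪-trans : ∀ {u v w} → (F ∪ F₁) u v → (F ∪ F₁) v w → (F ∪ F₁) u w
    ∪-trans (inj₁ Fuv)  (inj₁ Fvw)  = inj₁ (F-trans Fuv Fvw)
    ∪-trans (inj₂ F₁uv) (inj₂ F₁vw) = inj₂ (transitive F₁uv F₁vw)
    -- In the mixed cases a closing arc from `w` to `u` of either kind would compose with the given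
    -- arc of its own kind and reverse the other one, so that an edge of the graph would also be an
    -- edge of the complement.
    ∪-trans {u} {v} {w} (inj₁ Fuv) (inj₂ F₁vw) with compare u w
    ... | tri< Tuw _ _         = Tuw
    ... | tri≈ _ refl _        = contradiction Fuv (F₁⇒¬F⁻¹ F₁vw)
    ... | tri> _ _ (inj₁ Fwu)  = contradiction (F-trans Fwu Fuv) (F₁⇒¬F⁻¹ F₁vw)
    ... | tri> _ _ (inj₂ F₁wu) = contradiction Fuv (F₁⇒¬F⁻¹ (transitive F₁vw F₁wu))
    ∪-trans {u} {v} {w} (inj₂ F₁uv) (inj₁ Fvw) with compare u w
    ... | tri< Tuw _ _         = Tuw
    ... | tri≈ _ refl _        = contradiction Fvw (F₁⇒¬F⁻¹ F₁uv)
    ... | tri> _ _ (inj₁ Fwu)  = contradiction (F-trans Fvw Fwu) (F₁⇒¬F⁻¹ F₁uv)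
    ... | tri> _ _ (inj₂ F₁wu) = contradiction Fvw (F₁⇒¬F⁻¹ (transitive F₁wu F₁uv))

  ∪-isStrictTotalOrder : IsStrictTotalOrder _≡_ (F ∪ F₁)
  ∪-isStrictTotalOrder = isStrictTotalOrderᶜ record
    { isEquivalence = isEquivalence
    ; trans         = ∪-trans
    ; compare       = compare
    }

-- Existence of the induced permutation.

flip-isDecStrictPartialOrder : {F : Rel V 0ℓ} → IsDecStrictPartialOrder _≡_ F →
                               IsDecStrictPartialOrder _≡_ (Fun.flip F)
flip-isDecStrictPartialOrder isDecSPO = record
  { isStrictPartialOrder = Flip.isStrictPartialOrder isStrictPartialOrder
  ; _≟_                  = _≟ᵛ_
  ; _<?_                 = Fun.flip _F?_
  }
  where open IsDecStrictPartialOrder isDecSPO using (isStrictPartialOrder) renaming (_≟_ to _≟ᵛ_; _<?_ to _F?_)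

-- Reversing all arcs keeps the underlying graph. This supplies the second total order, in which `F`
-- is reversed and `F₁` is kept.
flip-complement : {F F₁ : Rel V 0ℓ} →
                  IsTransitiveOrientation (Complement (Underlying F)) F₁ →
                  IsTransitiveOrientation (Complement (Underlying (Fun.flip F))) F₁
flip-complement isTO = record
  { edge        = Product.map₂ (_∘ swap) ∘ edge
  ; exactly-one = exactly-one ∘ Product.map₂ (_∘ swap)
  ; transitive  = transitive
  }
  where
  open IsTransitiveOrientation isTO

  swap : ∀ {R : Rel _ 0ℓ} {u v} → SymClosure R u v → SymClosure (Fun.flip R) u v
  swap (fwd Ruv) = bwd Ruv
  swap (bwd Rvu) = fwd Rvu

induced : {F F₁ : Rel (Fin n) 0ℓ} → IsDecStrictPartialOrder _≡_ F →
          IsTransitiveOrientation (Complement (Underlying F)) F₁ →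
          Σ (Permutation′ n) (Induces F F₁)
induced {n} {F} {F₁} isDecSPO isTO
  with strictTotalOrder⇒ranking (∪-isStrictTotalOrder isDecSPO isTO)
     | strictTotalOrder⇒ranking (∪-isStrictTotalOrder (flip-isDecStrictPartialOrder isDecSPO) (flip-complement isTO))
-- `_∘ₚ_` applies its left factor first, so the inverse of this permutation sends a position under
-- `L` to the position under `L′`. Its inversions are the pairs that the two orders rank oppositely.
... | L , L-order | L′ , L′-order = flip L′ ∘ₚ L , L , L-order , λ i j → mk⇔ (forth i j) (back i j)
  where
  open IsTransitiveOrientation isTO using (edge)
  open IsDecStrictPartialOrder isDecSPO using (asym)

  -- The orders can disagree only on an arc of `F`: otherwise `F₁` would contain both directions of
  -- one edge.
  both : ∀ {v w} → (F ∪ F₁) v w → (Fun.flip F ∪ F₁) w v → F v w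
  both (inj₁ Fvw)  _           = Fvw
  both (inj₂ _)    (inj₁ Fvw)  = Fvw
  both (inj₂ F₁vw) (inj₂ F₁wv) =
    [ (λ (_ , ¬F₁wv) → contradiction F₁wv ¬F₁wv) , (λ (¬F₁vw , _) → contradiction F₁vw ¬F₁vw) ]′
      (IsTransitiveOrientation.exactly-one isTO (edge F₁vw))

  forth : ∀ i j → E (flip L′ ∘ₚ L) i j → _
  forth i j (i<j , j<′i) =
    L ⟨$⟩ˡ i , L ⟨$⟩ˡ j , inverseʳ L , inverseʳ L ,
    both (to (L-order _ _) (subst₂ _<_ (sym (inverseʳ L)) (sym (inverseʳ L)) i<j))
         (to (L′-order _ _) j<′i)

  back : ∀ i j → _ → E (flip L′ ∘ₚ L) i j
  back i j (v , w , refl , refl , Fvw) =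
    from (L-order v w) (inj₁ Fvw) ,
    subst₂ (λ x y → L′ ⟨$⟩ʳ x < L′ ⟨$⟩ʳ y) (sym (inverseˡ L)) (sym (inverseˡ L))
      (from (L′-order w v) (inj₁ Fvw))

-- Transport of orientations along an automorphism of `F`.

IsAutomorphism : Rel V 0ℓ → (V → V) → Set
IsAutomorphism F f = IsImageUnder f F F

module _ {F : Rel (Fin n) 0ℓ} (φ : Permutation′ n) (auto : IsAutomorphism F (φ ⟨$⟩ʳ_)) where

  private
    auto⁻¹ : ∀ v w → F v w ⇔ F (φ ⟨$⟩ˡ v) (φ ⟨$⟩ˡ w)
    auto⁻¹ v w = subst₂ (λ x y → F x y ⇔ F (φ ⟨$⟩ˡ v) (φ ⟨$⟩ˡ w)) (inverseʳ φ) (inverseʳ φ) (auto _ _)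

    complement⁻¹ : ∀ {v w} → Complement (Underlying F) v w →
                   Complement (Underlying F) (φ ⟨$⟩ˡ v) (φ ⟨$⟩ˡ w)
    complement⁻¹ {v} {w} (v≢w , ¬Gvw) =
      v≢w ∘ Injection.injective (↔⇒↣ (flip φ)) ,
      λ { (fwd e) → ¬Gvw (fwd (from (auto⁻¹ v w) e)) ; (bwd e) → ¬Gvw (bwd (from (auto⁻¹ w v) e)) }

    complement : ∀ {v w} → Complement (Underlying F) (φ ⟨$⟩ˡ v) (φ ⟨$⟩ˡ w) →
                 Complement (Underlying F) v w
    complement {v} {w} (≢ , ¬G) =
      ≢ ∘ cong (φ ⟨$⟩ˡ_) ,
      λ { (fwd e) → ¬G (fwd (to (auto⁻¹ v w) e)) ; (bwd e) → ¬G (bwd (to (auto⁻¹ w v) e)) }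

  module _ {F₁ F₂ : Rel (Fin n) 0ℓ} (image : IsImageUnder (φ ⟨$⟩ʳ_) F₁ F₂) where

    private
      -- As `φ` is onto, the condition on pairs of images determines `F₂` on all pairs.
      image⁻¹ : ∀ v w → F₂ v w ⇔ F₁ (φ ⟨$⟩ˡ v) (φ ⟨$⟩ˡ w)
      image⁻¹ v w = subst₂ (λ x y → F₂ x y ⇔ F₁ (φ ⟨$⟩ˡ v) (φ ⟨$⟩ˡ w)) (inverseʳ φ) (inverseʳ φ) (image _ _)

    image-isTransitiveOrientation : IsTransitiveOrientation (Complement (Underlying F)) F₁ →
                                    IsTransitiveOrientation (Complement (Underlying F)) F₂
    image-isTransitiveOrientation isTO = record
      { edge        = λ {v} {w} F₂vw → complement (edge (to (image⁻¹ v w) F₂vw))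
      ; exactly-one = λ {v} {w} Gᶜvw → Sum.map
          (Product.map (from (image⁻¹ v w)) (_∘ to (image⁻¹ w v)))
          (Product.map (_∘ to (image⁻¹ v w)) (from (image⁻¹ w v)))
          (exactly-one (complement⁻¹ Gᶜvw))
      ; transitive  = λ {u} {v} {w} F₂uv F₂vw →
          from (image⁻¹ u w) (transitive (to (image⁻¹ u v) F₂uv) (to (image⁻¹ v w) F₂vw))
      }
      where open IsTransitiveOrientation isTO

    -- Each vertex takes the position of its preimage under `φ`. Since `φ` permutes the arcs of `F`,
    -- the set of position pairs of these arcs stays the same.
    image-induces : ∀ {π} → Induces F F₁ π → Induces F F₂ π
    image-induces (L , order , arcs) =
      flip φ ∘ₚ L ,
      (λ v w → mk⇔
        (Sum.map (from (auto⁻¹ v w)) (from (image⁻¹ v w)) ∘ to (order _ _))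
        (from (order _ _) ∘ Sum.map (to (auto⁻¹ v w)) (to (image⁻¹ v w)))) ,
      λ i j → mk⇔
        (λ Eij → let v , w , v↦i , w↦j , Fvw = to (arcs i j) Eij in
          φ ⟨$⟩ʳ v , φ ⟨$⟩ʳ w ,
          trans (cong (L ⟨$⟩ʳ_) (inverseˡ φ)) v↦i ,
          trans (cong (L ⟨$⟩ʳ_) (inverseˡ φ)) w↦j ,
          from (auto v w) Fvw)
        (λ (v , w , v↦i , w↦j , Fvw) →
          from (arcs i j) (φ ⟨$⟩ˡ v , φ ⟨$⟩ˡ w , v↦i , w↦j , to (auto⁻¹ v w) Fvw))

-- Components of `G ∣ M` and children of a 0-node.

-- Both sets are the reachability class of the shared vertex; this is the source of the disjointness
-- of distinct children.
component-unique : {G : Rel (Fin n) 0ℓ} {M X Y : Subset n} → IsComponent G M X → IsComponent G M Y →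
                   ∀ {v} → v ∈ X → v ∈ Y → X ≡ Y
component-unique cX cY v∈X v∈Y = ⊆-antisym (half cX cY v∈X v∈Y) (half cY cX v∈Y v∈X)
  where
  half : ∀ {G : Rel (Fin _) 0ℓ} {M X Y} → IsComponent G M X → IsComponent G M Y →
         ∀ {v} → v ∈ X → v ∈ Y → ∀ {u} → u ∈ X → u ∈ Y
  half cX cY v∈X v∈Y u∈X =
    from (IsComponent.class cY v∈M u∈M v∈Y) (to (IsComponent.class cX v∈M u∈M v∈X) u∈X)
    where
    v∈M = IsComponent.subset cX v∈X
    u∈M = IsComponent.subset cX u∈X

component-nonadjacent : {G : Rel (Fin n) 0ℓ} {M X : Subset n} → IsComponent G M X →
                        ∀ {v w} → v ∈ X → w ∈ M → w ∉ X → ¬ G v w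
component-nonadjacent cX v∈X w∈M w∉X Gvw = w∉X (from (class (subset v∈X) w∈M v∈X) (Gvw ◅ ε))
  where open IsComponent cX

-- A component that exhausted `M` would make `G ∣ M` connected. The vertex found here later links
-- two vertices of the same component.
component-proper : {G : Rel (Fin n) 0ℓ} {M X : Subset n} → ¬ Connected (G ∣ M) → IsComponent G M X →
                   ∃ λ c → c ∈ M × c ∉ X
component-proper {M = M} {X} disconnected cX with any? (λ c → (c ∈? M) ×-dec ¬? (c ∈? X))
... | yes found = found
... | no  none  = contradiction
  (λ (u , u∈M) (v , v∈M) → to (IsComponent.class cX u∈M v∈M (M⊆X u∈M)) (M⊆X v∈M))
  disconnected
  where
  M⊆X : ∀ {v} → v ∈ M → v ∈ X
  M⊆X {v} v∈M = decidable-stable (v ∈? X) (λ v∉X → none (v , v∈M , v∉X))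

child⇒component : {G : Rel (Fin n) 0ℓ} {M X : Subset n} → ¬ Connected (G ∣ M) → IsChild G M X →
                  IsComponent G M X
child⇒component _            (child₀ _ cX) = cX
child⇒component disconnected (child₁ d _)  = contradiction (IsDegenerate1.connected d) disconnected
child⇒component disconnected (childₚ p _)  = contradiction (IsPrime.connected p) disconnected

-- Arcs between a module and its outside.

module _ {F : Rel (Fin n) 0ℓ} (isDecSPO : IsDecStrictPartialOrder _≡_ F)
         {M : Subset n} (M-module : IsModule (Underlying F) M) where

  open IsDecStrictPartialOrder isDecSPO using () renaming (trans to F-trans)

  SameArcs : Rel (Fin n) 0ℓ
  SameArcs a b = ∀ {w} → w ∉ M → (F a w → F b w) × (F w a → F w b)

  module-adjacent : ∀ {a b w} → a ∈ M → b ∈ M → w ∉ M → Underlying F w a → Underlying F w b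
  module-adjacent {w = w} a∈M b∈M w∉M Gwa with M-module w w∉M
  ... | inj₁ all  = all _ b∈M
  ... | inj₂ none = contradiction Gwa (none _ a∈M)

  -- A vertex outside `M` adjacent to `a` is adjacent to `b`. Were one arc to enter it and the other
  -- to leave it, transitivity through it would join `a` and `b`.
  nonadjacent⇒sameArcs : ∀ {a b} → a ∈ M → b ∈ M → ¬ Underlying F a b → SameArcs a b
  nonadjacent⇒sameArcs {a} {b} a∈M b∈M ¬Gab {w} w∉M = out , in′
    where
    out : F a w → F b w
    out Faw with module-adjacent a∈M b∈M w∉M (bwd Faw)
    ... | fwd Fwb = contradiction (fwd (F-trans Faw Fwb)) ¬Gab
    ... | bwd Fbw = Fbw

    in′ : F w a → F w b
    in′ Fwa with module-adjacent a∈M b∈M w∉M (fwd Fwa)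
    ... | fwd Fwb = Fwb
    ... | bwd Fbw = contradiction (bwd (F-trans Fbw Fwa)) ¬Gab

-- The map `shuffle` as an automorphism of `F`.

module Shuffle {F : Rel (Fin n) 0ℓ} (X : Fin m → Subset n)
               (disjoint : ∀ {i j v} → v ∈ X i → v ∈ X j → i ≡ j)
               (g : ∀ i j → (F ∣ X i) ≅ (F ∣ X j)) (ρ : Permutation′ m) where

  shuffle-∈ : ∀ {v i} (v∈Xᵢ : v ∈ X i) →
              shuffle X g ρ v ≡ proj₁ (_≅_.to (g i (ρ ⟨$⟩ʳ i)) (v , v∈Xᵢ))
  shuffle-∈ {v} v∈Xᵢ with any? (λ i → v ∈? X i)
  ... | no  none       = contradiction (_ , v∈Xᵢ) none
  -- The search may return another index and another membership proof; disjointness identifies the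
  -- former, proof irrelevance the latter.
  ... | yes (j , v∈Xⱼ) with refl ← disjoint v∈Xᵢ v∈Xⱼ
                       with refl ← []=-irrelevant v∈Xᵢ v∈Xⱼ = refl

  shuffle-∉ : ∀ {v} → (∀ i → v ∉ X i) → shuffle X g ρ v ≡ v
  shuffle-∉ {v} v∉X with any? (λ i → v ∈? X i)
  ... | no  _          = refl
  ... | yes (i , v∈Xᵢ) = contradiction v∈Xᵢ (v∉X i)

  shuffle-maps : ∀ {v i} → v ∈ X i → shuffle X g ρ v ∈ X (ρ ⟨$⟩ʳ i)
  shuffle-maps {i = i} v∈Xᵢ =
    subst (_∈ X (ρ ⟨$⟩ʳ i)) (sym (shuffle-∈ v∈Xᵢ)) (proj₂ (_≅_.to (g i (ρ ⟨$⟩ʳ i)) (_ , v∈Xᵢ)))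

  locate : ∀ v → (∃ λ i → v ∈ X i) ⊎ (∀ i → v ∉ X i)
  locate v with any? (λ i → v ∈? X i)
  ... | yes found = inj₁ found
  ... | no  none  = inj₂ (λ i v∈Xᵢ → none (i , v∈Xᵢ))

  ρ-injective : ∀ {i j} → ρ ⟨$⟩ʳ i ≡ ρ ⟨$⟩ʳ j → i ≡ j
  ρ-injective = Injection.injective (↔⇒↣ ρ)

  -- The image reveals the location of its argument: vertices outside all `X i` stay there, and
  -- `X i` goes into `X (ρ i)`. Within one child the isomorphism is injective.
  shuffle-injective : Injective _≡_ _≡_ (shuffle X g ρ)
  shuffle-injective {v} {w} eq with locate v | locate w
  ... | inj₂ v∉X | inj₂ w∉X = trans (sym (shuffle-∉ v∉X)) (trans eq (shuffle-∉ w∉X))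
  ... | inj₁ (i , v∈Xᵢ) | inj₂ w∉X =
    contradiction (subst (_∈ X _) (trans eq (shuffle-∉ w∉X)) (shuffle-maps v∈Xᵢ)) (w∉X _)
  ... | inj₂ v∉X | inj₁ (j , w∈Xⱼ) =
    contradiction (subst (_∈ X _) (trans (sym eq) (shuffle-∉ v∉X)) (shuffle-maps w∈Xⱼ)) (v∉X _)
  ... | inj₁ (i , v∈Xᵢ) | inj₁ (j , w∈Xⱼ)
    with refl ← ρ-injective (disjoint (subst (_∈ X _) eq (shuffle-maps v∈Xᵢ)) (shuffle-maps w∈Xⱼ)) =
    cong proj₁ (Injection.injective (↔⇒↣ (_≅_.bijection (g i (ρ ⟨$⟩ʳ i))))
      (∈-ext (trans (sym (shuffle-∈ v∈Xᵢ)) (trans eq (shuffle-∈ w∈Xⱼ)))))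
    where
    ∈-ext : ∀ {k} {x y : ∃ (_∈ X k)} → proj₁ x ≡ proj₁ y → x ≡ y
    ∈-ext {x = _ , p} {y = _ , q} refl = cong (_ ,_) ([]=-irrelevant p q)

  module _ (isDecSPO : IsDecStrictPartialOrder _≡_ F)
           {M : Subset n} (M-module : IsModule (Underlying F) M)
           (disconnected : ¬ Connected (Underlying F ∣ M))
           (component : ∀ i → IsComponent (Underlying F) M (X i)) where

    private
      X⊆M : ∀ i {v} → v ∈ X i → v ∈ M
      X⊆M i = IsComponent.subset (component i)

    nonadjacent : ∀ {i v w} → v ∈ X i → w ∈ M → w ∉ X i → ¬ Underlying F v w
    nonadjacent {i} = component-nonadjacent (component i)

    children-sameArcs : ∀ {i j a b} → a ∈ X i → b ∈ X j → SameArcs isDecSPO M-module a b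
    children-sameArcs {i} {j} {a} {b} a∈Xᵢ b∈Xⱼ with b ∈? X i
    ... | no b∉Xᵢ = nonadjacent⇒sameArcs isDecSPO M-module (X⊆M i a∈Xᵢ) (X⊆M j b∈Xⱼ)
                      (nonadjacent a∈Xᵢ (X⊆M j b∈Xⱼ) b∉Xᵢ)
    -- Here `a` and `b` may be adjacent, so the comparison goes through a vertex `c` of `M` in
    -- another component, adjacent to neither.
    ... | yes b∈Xᵢ with c , c∈M , c∉Xᵢ ← component-proper disconnected (component i) =
      λ w∉M → Product.zip (λ p q → q ∘ p) (λ p q → q ∘ p) (a⇝c w∉M) (c⇝b w∉M)
      where
      a⇝c = nonadjacent⇒sameArcs isDecSPO M-module (X⊆M i a∈Xᵢ) c∈M (nonadjacent a∈Xᵢ c∈M c∉Xᵢ)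
      c⇝b = nonadjacent⇒sameArcs isDecSPO M-module c∈M (X⊆M i b∈Xᵢ)
              (nonadjacent b∈Xᵢ c∈M c∉Xᵢ ∘ symmetric F)

    -- A vertex of `M` in none of the chosen children lies in another component and has no arcs to
    -- them; for a vertex outside `M`, the module property decides.
    outside-arcs : ∀ {i j a b w} → a ∈ X i → b ∈ X j → (∀ k → w ∉ X k) →
                   (F a w → F b w) × (F w a → F w b)
    outside-arcs {w = w} a∈Xᵢ b∈Xⱼ w∉X with w ∈? M
    ... | no w∉M  = children-sameArcs a∈Xᵢ b∈Xⱼ w∉M
    ... | yes w∈M = (λ Faw → contradiction (fwd Faw) (nonadjacent a∈Xᵢ w∈M (w∉X _))) ,
                    (λ Fwa → contradiction (bwd Fwa) (nonadjacent a∈Xᵢ w∈M (w∉X _)))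

    no-arcs-between : ∀ {i j a b} → i ≢ j → a ∈ X i → b ∈ X j → ¬ F a b
    no-arcs-between {j = j} i≢j a∈Xᵢ b∈Xⱼ Fab =
      nonadjacent a∈Xᵢ (X⊆M j b∈Xⱼ) (λ b∈Xᵢ → i≢j (disjoint b∈Xᵢ b∈Xⱼ)) (fwd Fab)

    -- If one end moves, its old and new places have the same arcs to the fixed end. If both lie in
    -- one child, the isomorphism preserves arcs. Distinct children carry no arcs between them, and
    -- injectivity of `ρ` keeps them distinct.
    shuffle-isAutomorphism : IsAutomorphism F (shuffle X g ρ)
    shuffle-isAutomorphism v w with locate v | locate w
    ... | inj₂ v∉X | inj₂ w∉X rewrite shuffle-∉ v∉X | shuffle-∉ w∉X = ⇔-id _
    ... | inj₁ (i , v∈Xᵢ) | inj₂ w∉X rewrite shuffle-∉ w∉X =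
      mk⇔ (proj₁ (outside-arcs (shuffle-maps v∈Xᵢ) v∈Xᵢ w∉X))
          (proj₁ (outside-arcs v∈Xᵢ (shuffle-maps v∈Xᵢ) w∉X))
    ... | inj₂ v∉X | inj₁ (j , w∈Xⱼ) rewrite shuffle-∉ v∉X =
      mk⇔ (proj₂ (outside-arcs (shuffle-maps w∈Xⱼ) w∈Xⱼ v∉X))
          (proj₂ (outside-arcs w∈Xⱼ (shuffle-maps w∈Xⱼ) v∉X))
    ... | inj₁ (i , v∈Xᵢ) | inj₁ (j , w∈Xⱼ) with i ≟ j
    ...   | yes refl = subst₂ (λ x y → F x y ⇔ F v w) (sym (shuffle-∈ v∈Xᵢ)) (sym (shuffle-∈ w∈Xⱼ))
                         (⇔-sym (_≅_.arcs (g i (ρ ⟨$⟩ʳ i)) (v , v∈Xᵢ) (w , w∈Xⱼ)))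
    ...   | no i≢j   = mk⇔
      (λ Ffvfw → contradiction Ffvfw
        (no-arcs-between (i≢j ∘ ρ-injective) (shuffle-maps v∈Xᵢ) (shuffle-maps w∈Xⱼ)))
      (λ Fvw → contradiction Fvw (no-arcs-between i≢j v∈Xᵢ w∈Xⱼ))

theorem5 : ∀ (n : ℕ) (F : Rel (Fin n) 0ℓ) → IsPermutationDigraph F →
    (M : Subset n) → IsDegenerate0 (Underlying F) M →
    (m : ℕ) (X : Fin m → Subset n) → Injective _≡_ _≡_ X →
    (∀ i → IsChild (Underlying F) M (X i)) →
    (g : ∀ i j → (F ∣ X i) ≅ (F ∣ X j)) →
    (ρ : Permutation′ m) →
    (F₁ : Rel (Fin n) 0ℓ) →
    IsTransitiveOrientation (Complement (Underlying F)) F₁ →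
    (Σ (Rel (Fin n) 0ℓ) λ F₂ → IsImageUnder (shuffle X g ρ) F₁ F₂) ×
    (∀ (F₂ : Rel (Fin n) 0ℓ) → IsImageUnder (shuffle X g ρ) F₁ F₂ →
    IsTransitiveOrientation (Complement (Underlying F)) F₂ ×
    (Σ (Permutation′ n) λ π → Induces F F₁ π × Induces F F₂ π))
theorem5 n F pd M deg m X X-inj child g ρ F₁ isTO =
  -- The relation `F₂` is obtained by pulling `F₁` back along the inverse of the shuffle.
  ((λ a b → F₁ (φ ⟨$⟩ˡ a) (φ ⟨$⟩ˡ b)) ,
   λ v w → subst₂ (λ x y → F₁ x y ⇔ F₁ v w) (sym (φ⁻¹-shuffle v)) (sym (φ⁻¹-shuffle w)) (⇔-id _)) ,
  λ F₂ image →
    image-isTransitiveOrientation φ φ-auto image isTO ,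
    proj₁ π , proj₂ π , image-induces φ φ-auto image {proj₁ π} (proj₂ π)
  where
  open IsDegenerate0 deg using (node; disconnected)

  isDecSPO = permutationDigraph⇒isDecStrictPartialOrder pd

  component : ∀ i → IsComponent (Underlying F) M (X i)
  component i = child⇒component disconnected (child i)

  -- Children sharing a vertex are equal as sets, and injectivity of `X` turns this into equality of
  -- indices.
  open Shuffle X (λ v∈Xᵢ v∈Xⱼ → X-inj (component-unique (component _) (component _) v∈Xᵢ v∈Xⱼ)) g ρ

  φ : Permutation′ n
  φ = proj₁ (injective⇒permutation (shuffle X g ρ) shuffle-injective)

  φ⁻¹-shuffle : ∀ v → φ ⟨$⟩ˡ (shuffle X g ρ v) ≡ v
  φ⁻¹-shuffle v = inverseˡ φ

  φ-auto : IsAutomorphism F (φ ⟨$⟩ʳ_)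
  φ-auto = shuffle-isAutomorphism isDecSPO (proj₁ (proj₂ node)) disconnected component

  π = induced isDecSPO isTO
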